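{- The translation of CGV into APCP preserves typing (up to priority requirements): (1) For every derivation of $\Gamma\vdash_{\mathtt M}M:T$, its translation $[\![M]\!]z$ satisfies $[\![M]\!]z\vdash^{*}\overline{[\![\Gamma]\!]},\,z:[\![T]\!]$. (2) For every derivation of $\Gamma\vdash_{\mathtt C}^{\phi}C:T$, its translation $[\![C]\!]z$ satisfies $[\![C]\!]z\vdash^{*}\overline{[\![\Gamma]\!]},\,z:[\![T]\!]$. (3) For every derivation of $\Gamma\vdash_{\mathtt B}[\vec m\rangle:S'>S$ and every process $P$ with $P\vdash^{*}\Lambda,\,x:\overline{[\![S']\!]}$, the translation $[\![\,[\vec m\rangle\,]\!]_x^{P}$ satisfies $[\![\,[\vec m\rangle\,]\!]_x^{P}\vdash^{*}\overline{[\![\Gamma]\!]},\,\Lambda,\,x:\overline{[\![S]\!]}$.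
   Context: **CGV terms.** Runtime terms, with $x,y$ variables, $\ell,i,j$ labels, $I$ a set of labels: $M,N ::= x \mid () \mid \lambda x.M \mid M\,N \mid (M,N) \mid \mathsf{let}\,(x,y)=M\,\mathsf{in}\,N \mid \mathsf{new} \mid \mathsf{spawn}\,M \mid \mathsf{send}\,M \mid \mathsf{recv}\,M \mid \mathsf{select}\,\ell\,M \mid \mathsf{case}\,M\,\mathsf{of}\,\{i:N_i\}_{i\in I} \mid M\{\!\{N/x\}\!\} \mid \mathsf{send}'(M,N)$; $M\{\!\{N/x\}\!\}$ is an explicit substitution. Markers $\phi ::= \mathsf{main}\mid\lozenge$; messages $m ::= M\mid\ell$; configurations $C,D ::= \phi\,M \mid C\parallel D \mid (\nu x[\vec m\rangle y)C \mid C\{\!\{M/x\}\!\}$, with $\vec m$ a finite sequence of messages ($\epsilon$ empty). **CGV types.** $T,U ::= T\times U \mid T\multimap U \mid \mathbf 1 \mid S$; session types $S ::= {!}T.S \mid {?}T.S \mid \oplus\{i:S_i\}_{i\in I} \mid \&\{i:S_i\}_{i\in I} \mid \mathsf{end}$. Duality: $\overline{{!}T.S}={?}T.\overline S$, $\overline{{?}T.S}={!}T.\overline S$, $\overline{\oplus\{i:S_i\}}=\&\{i:\overline{S_i}\}$, $\overline{\&\{i:S_i\}}=\oplus\{i:\overline{S_i}\}$, $\overline{\mathsf{end}}=\mathsf{end}$. Environments $\Gamma,\Delta$ assign types to distinct variables. **Term typing**: (T-Var) $x:T\vdash_{\mathtt M}x:T$. (T-Abs) $\Gamma,x:T\vdash_{\mathtt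 M}M:U$ gives $\Gamma\vdash_{\mathtt M}\lambda x.M:T\multimap U$. (T-App) $\Gamma\vdash_{\mathtt M}M:T\multimap U$, $\Delta\vdash_{\mathtt M}N:T$ give $\Gamma,\Delta\vdash_{\mathtt M}M\,N:U$. (T-Unit) $\emptyset\vdash_{\mathtt M}():\mathbf 1$. (T-Pair) $\Gamma\vdash_{\mathtt M}M:T$, $\Delta\vdash_{\mathtt M}N:U$ give $\Gamma,\Delta\vdash_{\mathtt M}(M,N):T\times U$. (T-Split) $\Gamma\vdash_{\mathtt M}M:T\times T'$, $\Delta,x:T,y:T'\vdash_{\mathtt M}N:U$ give $\Gamma,\Delta\vdash_{\mathtt M}\mathsf{let}\,(x,y)=M\,\mathsf{in}\,N:U$. (T-New) $\emptyset\vdash_{\mathtt M}\mathsf{new}:S\times\overline S$. (T-Spawn) $\Gamma\vdash_{\mathtt M}M:\mathbf 1\times T$ gives $\Gamma\vdash_{\mathtt M}\mathsf{spawn}\,M:T$. (T-EndL) $\Gamma\vdash_{\mathtt M}M:T$ gives $\Gamma,x:\mathsf{end}\vdash_{\mathtt M}M:T$. (T-EndR) $\emptyset\vdash_{\mathtt M}x:\mathsf{end}$. (T-Send) $\Gamma\vdash_{\mathtt M}M:T\times{!}T.S$ gives $\Gamma\vdash_{\mathtt M}\mathsf{send}\,M:S$. (T-Recv) $\Gamma\vdash_{\mathtt M}M:{?}T.S$ gives $\Gamma\vdash_{\mathtt M}\mathsf{recv}\,M:T\times S$. (T-Select) $\Gamma\vdash_{\mathtt M}M:\oplus\{i:S_i\}_{i\in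 I}$, $j\in I$ give $\Gamma\vdash_{\mathtt M}\mathsf{select}\,j\,M:S_j$. (T-Case) $\Gamma\vdash_{\mathtt M}M:\&\{i:S_i\}_{i\in I}$ and $\Delta\vdash_{\mathtt M}N_i:S_i\multimap U$ for all $i\in I$ give $\Gamma,\Delta\vdash_{\mathtt M}\mathsf{case}\,M\,\mathsf{of}\,\{i:N_i\}_{i\in I}:U$. (T-Sub) $\Gamma,x:T\vdash_{\mathtt M}M:U$, $\Delta\vdash_{\mathtt M}N:T$ give $\Gamma,\Delta\vdash_{\mathtt M}M\{\!\{N/x\}\!\}:U$. (T-Send') $\Gamma\vdash_{\mathtt M}M:T$, $\Delta\vdash_{\mathtt M}N:{!}T.S$ give $\Gamma,\Delta\vdash_{\mathtt M}\mathsf{send}'(M,N):S$. **Buffer typing**: (T-Buf) $\emptyset\vdash_{\mathtt B}[\epsilon\rangle:S'>S'$. (T-BufSend) $\Gamma\vdash_{\mathtt M}M:T$, $\Delta\vdash_{\mathtt B}[\vec m\rangle:S'>S$ give $\Gamma,\Delta\vdash_{\mathtt B}[\vec m,M\rangle:S'>{!}T.S$. (T-BufSelect) $\Gamma\vdash_{\mathtt B}[\vec m\rangle:S'>S_j$, $j\in I$ give $\Gamma\vdash_{\mathtt B}[\vec m,j\rangle:S'>\oplus\{i:S_i\}_{i\in I}$. **Configuration typing**, with $\mathsf{main}+\lozenge=\lozenge+\mathsf{main}=\mathsf{main}$, $\lozenge+\lozenge=\lozenge$, $\mathsf{main}+\mathsf{main}$ undefined: (T-Main) $\Gamma\vdash_{\mathtt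 M}M:T$ gives $\Gamma\vdash_{\mathtt C}^{\mathsf{main}}\mathsf{main}\,M:T$. (T-Child) $\Gamma\vdash_{\mathtt M}M:\mathbf 1$ gives $\Gamma\vdash_{\mathtt C}^{\lozenge}\lozenge\,M:\mathbf 1$. (T-ParL) $\Gamma\vdash_{\mathtt C}^{\lozenge}C:\mathbf 1$, $\Delta\vdash_{\mathtt C}^{\phi}D:T$ give $\Gamma,\Delta\vdash_{\mathtt C}^{\lozenge+\phi}C\parallel D:T$. (T-ParR) $\Gamma\vdash_{\mathtt C}^{\phi}C:T$, $\Delta\vdash_{\mathtt C}^{\lozenge}D:\mathbf 1$ give $\Gamma,\Delta\vdash_{\mathtt C}^{\phi+\lozenge}C\parallel D:T$. (T-Res) $\Gamma\vdash_{\mathtt B}[\vec m\rangle:S'>S$, $\Delta,x:S',y:\overline S\vdash_{\mathtt C}^{\phi}C:T$ give $\Gamma,\Delta\vdash_{\mathtt C}^{\phi}(\nu x[\vec m\rangle y)C:T$. (T-ResBuf) $\Gamma,y:\overline S\vdash_{\mathtt B}[\vec m\rangle:S'>S$, $\Delta,x:S'\vdash_{\mathtt C}^{\phi}C:T$ give $\Gamma,\Delta\vdash_{\mathtt C}^{\phi}(\nu x[\vec m\rangle y)C:T$. (T-ConfSub) $\Gamma,x:T\vdash_{\mathtt C}^{\phi}C:U$, $\Delta\vdash_{\mathtt M}M:T$ give $\Gamma,\Delta\vdash_{\mathtt C}^{\phi}C\{\!\{M/x\}\!\}:U$. **APCP processes.** $P,Q ::= x[y,z] \mid x(y,z).P \mid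 x[z]\triangleleft i \mid x(z)\triangleright\{i:P_i\}_{i\in I} \mid (\nu xy)P \mid P\mid Q \mid \mathbf 0 \mid x\leftrightarrow y$. Some restrictions are written $(\nu^{\leftrightarrow}xy)P$ (an annotation irrelevant for typing). APCP session types (with $\wp$ the linear-logic "par"): $A,B ::= A\otimes B \mid A\wp B \mid \oplus\{i:A_i\}_{i\in I} \mid \&\{i:A_i\}_{i\in I} \mid \bullet$; dual: $\overline{A\otimes B}=\overline A\wp\overline B$, $\overline{A\wp B}=\overline A\otimes\overline B$, $\overline{\oplus\{i:A_i\}}=\&\{i:\overline{A_i}\}$, $\overline{\&\{i:A_i\}}=\oplus\{i:\overline{A_i}\}$, $\overline\bullet=\bullet$. (In full APCP the connectives carry priority annotations; they are disregarded here.) The judgment $P\vdash^{*}\Gamma$ is APCP typing with all priority checks erased; $\Gamma$ is a linear context up to reordering: $\mathbf 0\vdash^{*}\emptyset$; $P\vdash^{*}\Gamma$ gives $P\vdash^{*}\Gamma,x:\bullet$; $x\leftrightarrow y\vdash^{*}x:\overline A,y:A$; $P\vdash^{*}\Gamma$, $Q\vdash^{*}\Delta$ give $P\mid Q\vdash^{*}\Gamma,\Delta$; $P\vdash^{*}\Gamma,x:A,y:\overline A$ gives $(\nu xy)P\vdash^{*}\Gamma$; $x[y,z]\vdash^{*}x:A\otimes B,y:\overline A,z:\overline B$; $P\vdash^{*}\Gamma,y:A,z:B$ gives $x(y,z).P\vdash^{*}\Gamma,x:A\wp B$; for $j\in I$, $x[z]\triangleleft j\vdash^{*}x:\oplus\{i:A_i\}_{i\in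 I},z:\overline{A_j}$; $P_i\vdash^{*}\Gamma,z:A_i$ for all $i\in I$ gives $x(z)\triangleright\{i:P_i\}_{i\in I}\vdash^{*}\Gamma,x:\&\{i:A_i\}_{i\in I}$. **Translation of types.** $[\![T\times U]\!]=([\![T]\!]\wp\bullet)\otimes([\![U]\!]\wp\bullet)$; $[\![T\multimap U]\!]=(\overline{[\![T]\!]}\otimes\bullet)\wp[\![U]\!]$; $[\![\mathbf 1]\!]=[\![\mathsf{end}]\!]=\bullet$; $[\![{!}T.S]\!]=(\overline{[\![T]\!]}\otimes\bullet)\wp[\![S]\!]$; $[\![{?}T.S]\!]=([\![T]\!]\wp\bullet)\otimes[\![S]\!]$; $[\![\oplus\{i:S_i\}]\!]=\&\{i:[\![S_i]\!]\}$; $[\![\&\{i:S_i\}]\!]=\oplus\{i:[\![S_i]\!]\}$. Extended pointwise to environments; $\overline{\Gamma}$ dualizes each type. **Translation of terms** $[\![M]\!]z$ (defined by recursion on the typing derivation, by last rule; newly introduced names are fresh): T-Var: $x\leftrightarrow z$. T-Unit: $\mathbf 0$. T-Abs: $z(a,b).(\nu^{\leftrightarrow}cx)((\nu ef)a[c,e]\mid[\![M]\!]b)$. T-App: $(\nu ab)([\![M]\!]a\mid(\nu cd)(b[c,z]\mid d(e,f).[\![N]\!]e))$. T-Pair: $(\nu ab)(\nu cd)(z[a,c]\mid b(e,f).[\![M]\!]e\mid d(g,h).[\![N]\!]g)$. T-Split: $(\nu ab)([\![M]\!]a\mid b(c,d).(\nu^{\leftrightarrow}ex)(\nu^{\leftrightarrow}fy)((\nu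 gh)c[e,g]\mid(\nu kl)d[f,k]\mid[\![N]\!]z))$. T-New: $(\nu ab)((\nu cd)a[c,d]\mid b(e,f).(\nu xy)[\![(x,y)]\!]z)$ (with $x:S,y:\overline S$). T-Spawn: $(\nu ab)([\![M]\!]a\mid b(c,d).((\nu ef)c[e,f]\mid(\nu gh)d[z,g]))$. T-EndL: $[\![M]\!]z$. T-EndR: $\mathbf 0$. T-Send: $(\nu ab)([\![M]\!]a\mid b(c,d).(\nu ef)((\nu gh)d[e,g]\mid(\nu kl)(f[c,k]\mid l\leftrightarrow z)))$. T-Recv: $(\nu ab)([\![M]\!]a\mid b(c,d).(\nu ef)(z[c,e]\mid f(g,h).d\leftrightarrow g))$. T-Select: $(\nu ab)([\![M]\!]a\mid(\nu cd)(b[c]\triangleleft j\mid d\leftrightarrow z))$. T-Case: $(\nu ab)([\![M]\!]a\mid b(c)\triangleright\{i:[\![N_i\,c]\!]z\}_{i\in I})$. T-Sub: $(\nu^{\leftrightarrow}xa)([\![M]\!]z\mid[\![N]\!]a)$. T-Send': $(\nu ab)(a(c,d).[\![M]\!]c\mid(\nu ef)([\![N]\!]e\mid(\nu gh)(f[b,g]\mid h\leftrightarrow z)))$. **Translation of buffers** $[\![\,[\vec m\rangle\,]\!]_x^{P}$, for a continuation process $P$ with $P\vdash^{*}\Lambda,x:\overline{[\![S']\!]}$: T-Buf: $P$. T-BufSend (for $[\vec m,M\rangle$): $(\nu ab)(\nu cd)((\nu gh)(x\leftrightarrow g\mid h[a,c])\mid b(e,f).[\![M]\!]e\mid[\![\,[\vec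 m\rangle\,]\!]_d^{P\{d/x\}})$. T-BufSelect (for $[\vec m,j\rangle$): $(\nu ab)((\nu cd)(x\leftrightarrow c\mid d[a]\triangleleft j)\mid[\![\,[\vec m\rangle\,]\!]_b^{P\{b/x\}})$. **Translation of configurations** $[\![C]\!]z$: T-Main/T-Child: $[\![\phi\,M]\!]z=[\![M]\!]z$. T-ParL: $(\nu ab)[\![C]\!]a\mid[\![D]\!]z$. T-ParR: $[\![C]\!]z\mid(\nu ab)[\![D]\!]a$. T-Res/T-ResBuf: $(\nu xy)[\![\,[\vec m\rangle\,]\!]_x^{[\![C]\!]z}$. T-ConfSub: $(\nu^{\leftrightarrow}xa)([\![C]\!]z\mid[\![M]\!]a)$. -}

module Defs where

open import Data.Fin using (Fin; #_; _↑ʳ_; lift)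
open import Data.List using (List; []; _∷ʳ_)
open import Data.Maybe as Maybe using (Maybe; just; nothing)
import Data.Maybe.Relation.Binary.Pointwise as MaybeP
open import Data.Nat using (ℕ; zero; suc; _+_)
open import Data.Vec using (Vec; []; _∷_; replicate; map; insertAt; _[_]=_; _[_]≔_)
import Data.Vec.Functional as Fun
open import Data.Vec.Relation.Binary.Pointwise.Inductive as VecP using ([]; _∷_)
open import Function using (_∘_; const)
open import Relation.Binary.PropositionalEquality using (_≡_)

-- Conventions.  Variables and process names are well-scoped de Bruijn
-- indices; a construct binding (x , y) gives x index 0 and y index 1.
-- Labels are drawn from a pool of L labels, where L is an arbitrary
-- parameter of all syntactic categories.

variable
  L m n : ℕ
  A : Set

-- Finite partial maps out of Fin n.  Over names they are environments
-- (distinctness and exchange are built in); over labels they are the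
-- families {i : Xᵢ}_{i ∈ I}, with I the domain of the map.
PMap : Set → ℕ → Set
PMap A n = Vec (Maybe A) n

∅ : PMap A n
∅ = replicate _ nothing

[_∶_] : Fin n → A → PMap A n
[ x ∶ a ] = ∅ [ x ]≔ just a

-- Γ extended with a name outside its scope, placed at index x.
_,[_∶_] : PMap A n → Fin (suc n) → A → PMap A (suc n)
Γ ,[ x ∶ a ] = insertAt Γ x (just a)

infix 4 _⊎ᵐ_≔_ _⊎_≔_

data _⊎ᵐ_≔_ {A : Set} : Maybe A → Maybe A → Maybe A → Set where
  none  : nothing ⊎ᵐ nothing ≔ nothing
  left  : ∀ {a} → just a ⊎ᵐ nothing ≔ just a
  right : ∀ {a} → nothing ⊎ᵐ just a ≔ just a

-- Γ ⊎ Δ ≔ Θ : the environment "Γ , Δ" is defined (disjoint domains) and is Θ.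
data _⊎_≔_ {A : Set} : ∀ {n} → PMap A n → PMap A n → PMap A n → Set where
  []  : [] ⊎ [] ≔ []
  _∷_ : ∀ {n a b c} {Γ Δ Θ : PMap A n} →
        a ⊎ᵐ b ≔ c → Γ ⊎ Δ ≔ Θ → (a ∷ Γ) ⊎ (b ∷ Δ) ≔ (c ∷ Θ)

-- Two families with the same index set, related at each index.
Branchwise : {A B : Set} (R : A → B → Set) → PMap A n → PMap B n → Set
Branchwise R = VecP.Pointwise (MaybeP.Pointwise R)

------------------------------------------------------------------------
-- CGV

infixr 7 _×ₜ_
infixr 6 _⊸_
infixr 8 !_∙_ ¿_∙_

mutual
  data Ty (L : ℕ) : Set where
    _×ₜ_ _⊸_ : Ty L → Ty L → Ty L
    𝟏        : Ty L
    sess     : STy L → Ty L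

  data STy (L : ℕ) : Set where
    !_∙_ ¿_∙_ : Ty L → STy L → STy L
    ⊕ &       : PMap (STy L) L → STy L
    end       : STy L

mutual
  dualˢ : STy L → STy L
  dualˢ (! T ∙ S) = ¿ T ∙ dualˢ S
  dualˢ (¿ T ∙ S) = ! T ∙ dualˢ S
  dualˢ (⊕ Ss)    = & (dualsˢ Ss)
  dualˢ (& Ss)    = ⊕ (dualsˢ Ss)
  dualˢ end       = end

  dualsˢ : PMap (STy L) n → PMap (STy L) n
  dualsˢ []             = []
  dualsˢ (nothing ∷ Ss) = nothing ∷ dualsˢ Ss
  dualsˢ (just S ∷ Ss)  = just (dualˢ S) ∷ dualsˢ Ss

infixl 8 _·_
infixl 9 _⟪_⟫

data Term (L : ℕ) : ℕ → Set where
  var    : Fin n → Term L n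
  unit   : Term L n
  ƛ      : Term L (suc n) → Term L n
  _·_    : Term L n → Term L n → Term L n
  pair   : Term L n → Term L n → Term L n
  split  : Term L n → Term L (2 + n) → Term L n
  new    : Term L n
  spawn  : Term L n → Term L n
  send   : Term L n → Term L n
  recv   : Term L n → Term L n
  select : Fin L → Term L n → Term L n
  case   : Term L n → PMap (Term L n) L → Term L n
  -- M ⟪ N ⟫ is the explicit substitution of N for index 0 of M.
  _⟪_⟫   : Term L (suc n) → Term L n → Term L n
  send′  : Term L n → Term L n → Term L n

data Marker : Set where
  main ◇ : Marker

_+ᵠ_ : Marker → Marker → Maybe Marker
main +ᵠ main = nothing
main +ᵠ ◇    = just main
◇    +ᵠ main = just main
◇    +ᵠ ◇    = just ◇

data Msg (L n : ℕ) : Set where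
  term  : Term L n → Msg L n
  label : Fin L → Msg L n

infixr 6 _∥_

data Conf (L : ℕ) : ℕ → Set where
  thread : Marker → Term L n → Conf L n
  _∥_    : Conf L n → Conf L n → Conf L n
  -- νbuf ms C is (νx[ms⟩y)C; x and y scope over both ms and C.
  νbuf   : List (Msg L (2 + n)) → Conf L (2 + n) → Conf L n
  _⟪_⟫   : Conf L (suc n) → Term L n → Conf L n

Env : ℕ → ℕ → Set
Env L n = PMap (Ty L) n

infix 3 _⊢ᴹ_∶_ _⊢ᴮ[_⟩∶_>_ _⊢ᶜ⟨_⟩_∶_

data _⊢ᴹ_∶_ {L : ℕ} : ∀ {n} → Env L n → Term L n → Ty L → Set where

  T-Var : ∀ {n} {x : Fin n} {T} → [ x ∶ T ] ⊢ᴹ var x ∶ T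

  T-Abs : ∀ {n} {Γ : Env L n} {M T U} →
    just T ∷ Γ ⊢ᴹ M ∶ U →
    Γ ⊢ᴹ ƛ M ∶ T ⊸ U

  T-App : ∀ {n} {Γ Δ Θ : Env L n} {M N T U} →
    Γ ⊢ᴹ M ∶ T ⊸ U → Δ ⊢ᴹ N ∶ T → Γ ⊎ Δ ≔ Θ →
    Θ ⊢ᴹ M · N ∶ U

  T-Unit : ∀ {n} → ∅ {n = n} ⊢ᴹ unit ∶ 𝟏

  T-Pair : ∀ {n} {Γ Δ Θ : Env L n} {M N T U} →
    Γ ⊢ᴹ M ∶ T → Δ ⊢ᴹ N ∶ U → Γ ⊎ Δ ≔ Θ →
    Θ ⊢ᴹ pair M N ∶ T ×ₜ U

  T-Split : ∀ {n} {Γ Δ Θ : Env L n} {M N T T′ U} →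
    Γ ⊢ᴹ M ∶ T ×ₜ T′ → just T ∷ just T′ ∷ Δ ⊢ᴹ N ∶ U → Γ ⊎ Δ ≔ Θ →
    Θ ⊢ᴹ split M N ∶ U

  T-New : ∀ {n S} → ∅ {n = n} ⊢ᴹ new ∶ sess S ×ₜ sess (dualˢ S)

  T-Spawn : ∀ {n} {Γ : Env L n} {M T} →
    Γ ⊢ᴹ M ∶ 𝟏 ×ₜ T →
    Γ ⊢ᴹ spawn M ∶ T

  T-EndL : ∀ {n} {Γ Θ : Env L n} {x M T} →
    Γ ⊢ᴹ M ∶ T → Γ ⊎ [ x ∶ sess end ] ≔ Θ →
    Θ ⊢ᴹ M ∶ T

  T-EndR : ∀ {n} {x : Fin n} → ∅ ⊢ᴹ var x ∶ sess end

  T-Send : ∀ {n} {Γ : Env L n} {M T S} →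
    Γ ⊢ᴹ M ∶ T ×ₜ sess (! T ∙ S) →
    Γ ⊢ᴹ send M ∶ sess S

  T-Recv : ∀ {n} {Γ : Env L n} {M T S} →
    Γ ⊢ᴹ M ∶ sess (¿ T ∙ S) →
    Γ ⊢ᴹ recv M ∶ T ×ₜ sess S

  T-Select : ∀ {n} {Γ : Env L n} {M Ss j S} →
    Γ ⊢ᴹ M ∶ sess (⊕ Ss) → Ss [ j ]= just S →
    Γ ⊢ᴹ select j M ∶ sess S

  T-Case : ∀ {n} {Γ Δ Θ : Env L n} {M Ns Ss U} →
    Γ ⊢ᴹ M ∶ sess (& Ss) →
    Branchwise (λ N S → Δ ⊢ᴹ N ∶ sess S ⊸ U) Ns Ss →
    Γ ⊎ Δ ≔ Θ →
    Θ ⊢ᴹ case M Ns ∶ U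

  T-Sub : ∀ {n} {Γ Δ Θ : Env L n} {M N T U} →
    just T ∷ Γ ⊢ᴹ M ∶ U → Δ ⊢ᴹ N ∶ T → Γ ⊎ Δ ≔ Θ →
    Θ ⊢ᴹ M ⟪ N ⟫ ∶ U

  T-Send′ : ∀ {n} {Γ Δ Θ : Env L n} {M N T S} →
    Γ ⊢ᴹ M ∶ T → Δ ⊢ᴹ N ∶ sess (! T ∙ S) → Γ ⊎ Δ ≔ Θ →
    Θ ⊢ᴹ send′ M N ∶ sess S

data _⊢ᴮ[_⟩∶_>_ {L n : ℕ} : Env L n → List (Msg L n) → STy L → STy L → Set where

  T-Buf : ∀ {S′} → ∅ ⊢ᴮ[ [] ⟩∶ S′ > S′

  T-BufSend : ∀ {Γ Δ Θ M ms T S′ S} →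
    Γ ⊢ᴹ M ∶ T → Δ ⊢ᴮ[ ms ⟩∶ S′ > S → Γ ⊎ Δ ≔ Θ →
    Θ ⊢ᴮ[ ms ∷ʳ term M ⟩∶ S′ > ! T ∙ S

  T-BufSelect : ∀ {Γ ms S′ S Ss j} →
    Γ ⊢ᴮ[ ms ⟩∶ S′ > S → Ss [ j ]= just S →
    Γ ⊢ᴮ[ ms ∷ʳ label j ⟩∶ S′ > ⊕ Ss

data _⊢ᶜ⟨_⟩_∶_ {L : ℕ} : ∀ {n} → Env L n → Marker → Conf L n → Ty L → Set where

  T-Main : ∀ {n} {Γ : Env L n} {M T} →
    Γ ⊢ᴹ M ∶ T →
    Γ ⊢ᶜ⟨ main ⟩ thread main M ∶ T

  T-Child : ∀ {n} {Γ : Env L n} {M} →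
    Γ ⊢ᴹ M ∶ 𝟏 →
    Γ ⊢ᶜ⟨ ◇ ⟩ thread ◇ M ∶ 𝟏

  T-ParL : ∀ {n} {Γ Δ Θ : Env L n} {C D T φ ψ} →
    Γ ⊢ᶜ⟨ ◇ ⟩ C ∶ 𝟏 → Δ ⊢ᶜ⟨ φ ⟩ D ∶ T → Γ ⊎ Δ ≔ Θ → ◇ +ᵠ φ ≡ just ψ →
    Θ ⊢ᶜ⟨ ψ ⟩ C ∥ D ∶ T

  T-ParR : ∀ {n} {Γ Δ Θ : Env L n} {C D T φ ψ} →
    Γ ⊢ᶜ⟨ φ ⟩ C ∶ T → Δ ⊢ᶜ⟨ ◇ ⟩ D ∶ 𝟏 → Γ ⊎ Δ ≔ Θ → φ +ᵠ ◇ ≡ just ψ →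
    Θ ⊢ᶜ⟨ ψ ⟩ C ∥ D ∶ T

  T-Res : ∀ {n} {Γ Δ Θ : Env L n} {ms C T S′ S φ} →
    nothing ∷ nothing ∷ Γ ⊢ᴮ[ ms ⟩∶ S′ > S →
    just (sess S′) ∷ just (sess (dualˢ S)) ∷ Δ ⊢ᶜ⟨ φ ⟩ C ∶ T →
    Γ ⊎ Δ ≔ Θ →
    Θ ⊢ᶜ⟨ φ ⟩ νbuf ms C ∶ T

  T-ResBuf : ∀ {n} {Γ Δ Θ : Env L n} {ms C T S′ S φ} →
    nothing ∷ just (sess (dualˢ S)) ∷ Γ ⊢ᴮ[ ms ⟩∶ S′ > S →
    just (sess S′) ∷ nothing ∷ Δ ⊢ᶜ⟨ φ ⟩ C ∶ T →
    Γ ⊎ Δ ≔ Θ →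
    Θ ⊢ᶜ⟨ φ ⟩ νbuf ms C ∶ T

  T-ConfSub : ∀ {n} {Γ Δ Θ : Env L n} {C M T U φ} →
    just T ∷ Γ ⊢ᶜ⟨ φ ⟩ C ∶ U → Δ ⊢ᴹ M ∶ T → Γ ⊎ Δ ≔ Θ →
    Θ ⊢ᶜ⟨ φ ⟩ C ⟪ M ⟫ ∶ U

------------------------------------------------------------------------
-- APCP (without priorities)

infixr 7 _⊗_ _⅋_

data AType (L : ℕ) : Set where
  _⊗_ _⅋_ : AType L → AType L → AType L
  ⊕ &     : PMap (AType L) L → AType L
  ●       : AType L

mutual
  dual : AType L → AType L
  dual (A ⊗ B) = dual A ⅋ dual B
  dual (A ⅋ B) = dual A ⊗ dual B
  dual (⊕ As)  = & (duals As)
  dual (& As)  = ⊕ (duals As)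
  dual ●       = ●

  duals : PMap (AType L) n → PMap (AType L) n
  duals []             = []
  duals (nothing ∷ As) = nothing ∷ duals As
  duals (just A ∷ As)  = just (dual A) ∷ duals As

-- The annotation distinguishing (νxy) from (ν↔xy).
data Ann : Set where
  plain fwd : Ann

infixr 6 _∣_
infixr 7 _⦅··⦆_ _⦅·⦆▷_ ν[_]_ ν_ ν↔_
infix  8 _[_,_] _[_]◁_ _↔_

-- x ⦅··⦆ P is x(y,z).P with y, z bound in P; x ⦅·⦆▷ Ps is x(z)▷{i:Pᵢ}
-- with z bound in every Pᵢ.
data Proc (L : ℕ) : ℕ → Set where
  _[_,_]  : Fin n → Fin n → Fin n → Proc L n
  _⦅··⦆_  : Fin n → Proc L (2 + n) → Proc L n
  _[_]◁_  : Fin n → Fin n → Fin L → Proc L n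
  _⦅·⦆▷_  : Fin n → PMap (Proc L (1 + n)) L → Proc L n
  ν[_]_   : Ann → Proc L (2 + n) → Proc L n
  _∣_     : Proc L n → Proc L n → Proc L n
  𝟎       : Proc L n
  _↔_     : Fin n → Fin n → Proc L n

pattern ν_ P  = ν[ plain ] P
pattern ν↔_ P = ν[ fwd ] P

mutual
  rename : (Fin n → Fin m) → Proc L n → Proc L m
  rename ρ (x [ y , z ])  = ρ x [ ρ y , ρ z ]
  rename ρ (x ⦅··⦆ P)     = ρ x ⦅··⦆ rename (lift 2 ρ) P
  rename ρ (x [ z ]◁ j)   = ρ x [ ρ z ]◁ j
  rename ρ (x ⦅·⦆▷ Ps)    = ρ x ⦅·⦆▷ renames (lift 1 ρ) Ps
  rename ρ (ν[ a ] P)     = ν[ a ] rename (lift 2 ρ) P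
  rename ρ (P ∣ Q)        = rename ρ P ∣ rename ρ Q
  rename ρ 𝟎              = 𝟎
  rename ρ (x ↔ y)        = ρ x ↔ ρ y

  renames : ∀ {k} → (Fin n → Fin m) → PMap (Proc L n) k → PMap (Proc L m) k
  renames ρ []             = []
  renames ρ (nothing ∷ Ps) = nothing ∷ renames ρ Ps
  renames ρ (just P ∷ Ps)  = just (rename ρ P) ∷ renames ρ Ps

-- P{d/x}, placed under k further binders; d may be one of the names they bind.
infix 9 _under_⟨_/_⟩
_under_⟨_/_⟩ : Proc L n → (k : ℕ) → Fin (k + n) → Fin n → Proc L (k + n)
P under k ⟨ d / x ⟩ = rename (Fun.updateAt (k ↑ʳ_) x (const d)) P

Ctx : ℕ → ℕ → Set
Ctx L n = PMap (AType L) n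

infix 3 _⊢*_

data _⊢*_ {L : ℕ} : ∀ {n} → Proc L n → Ctx L n → Set where

  ⊢𝟎 : ∀ {n} → 𝟎 {n = n} ⊢* ∅

  ⊢● : ∀ {n} {P} {Γ Θ : Ctx L n} {x} →
    P ⊢* Γ → Γ ⊎ [ x ∶ ● ] ≔ Θ →
    P ⊢* Θ

  ⊢↔ : ∀ {n} {x y A} {Θ : Ctx L n} →
    [ x ∶ dual A ] ⊎ [ y ∶ A ] ≔ Θ →
    x ↔ y ⊢* Θ

  ⊢∣ : ∀ {n} {P Q} {Γ Δ Θ : Ctx L n} →
    P ⊢* Γ → Q ⊢* Δ → Γ ⊎ Δ ≔ Θ →
    P ∣ Q ⊢* Θ

  ⊢ν : ∀ {n a P A} {Γ : Ctx L n} →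
    P ⊢* just A ∷ just (dual A) ∷ Γ →
    ν[ a ] P ⊢* Γ

  ⊢⊗ : ∀ {n x y z A B} {Γ Θ : Ctx L n} →
    [ x ∶ A ⊗ B ] ⊎ [ y ∶ dual A ] ≔ Γ → Γ ⊎ [ z ∶ dual B ] ≔ Θ →
    x [ y , z ] ⊢* Θ

  ⊢⅋ : ∀ {n x P A B} {Γ Θ : Ctx L n} →
    P ⊢* just A ∷ just B ∷ Γ → Γ ⊎ [ x ∶ A ⅋ B ] ≔ Θ →
    x ⦅··⦆ P ⊢* Θ

  ⊢⊕ : ∀ {n x z j As A} {Θ : Ctx L n} →
    As [ j ]= just A → [ x ∶ ⊕ As ] ⊎ [ z ∶ dual A ] ≔ Θ →
    x [ z ]◁ j ⊢* Θ

  ⊢& : ∀ {n x Ps As} {Γ Θ : Ctx L n} →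
    Branchwise (λ P A → P ⊢* just A ∷ Γ) Ps As → Γ ⊎ [ x ∶ & As ] ≔ Θ →
    x ⦅·⦆▷ Ps ⊢* Θ

------------------------------------------------------------------------
-- The translation

mutual
  ⟦_⟧ᵀ : Ty L → AType L
  ⟦ T ×ₜ U ⟧ᵀ = (⟦ T ⟧ᵀ ⅋ ●) ⊗ (⟦ U ⟧ᵀ ⅋ ●)
  ⟦ T ⊸ U ⟧ᵀ  = (dual ⟦ T ⟧ᵀ ⊗ ●) ⅋ ⟦ U ⟧ᵀ
  ⟦ 𝟏 ⟧ᵀ      = ●
  ⟦ sess S ⟧ᵀ = ⟦ S ⟧ˢ

  ⟦_⟧ˢ : STy L → AType L
  ⟦ ! T ∙ S ⟧ˢ = (dual ⟦ T ⟧ᵀ ⊗ ●) ⅋ ⟦ S ⟧ˢ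
  ⟦ ¿ T ∙ S ⟧ˢ = (⟦ T ⟧ᵀ ⅋ ●) ⊗ ⟦ S ⟧ˢ
  ⟦ ⊕ Ss ⟧ˢ    = & ⟦ Ss ⟧ˢˢ
  ⟦ & Ss ⟧ˢ    = ⊕ ⟦ Ss ⟧ˢˢ
  ⟦ end ⟧ˢ     = ●

  ⟦_⟧ˢˢ : PMap (STy L) n → PMap (AType L) n
  ⟦ [] ⟧ˢˢ           = []
  ⟦ nothing ∷ Ss ⟧ˢˢ = nothing ∷ ⟦ Ss ⟧ˢˢ
  ⟦ just S ∷ Ss ⟧ˢˢ  = just ⟦ S ⟧ˢ ∷ ⟦ Ss ⟧ˢˢ

⟦_⟧ᴱ : Env L n → Ctx L n
⟦ Γ ⟧ᴱ = map (Maybe.map ⟦_⟧ᵀ) Γ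

dualᴱ : Ctx L n → Ctx L n
dualᴱ Γ = map (Maybe.map dual) Γ

-- ⟦ d ⟧ᴹ ρ z is [[M]]z, where ρ says which process name stands for each
-- variable of M.  Freshness of the introduced names is enforced by shifting
-- ρ and z past each binder.  In the clauses, a name bound by the restrictions
-- and inputs enclosing it is #k, counting from the innermost; k ↑ʳ x is the
-- outer name x under k such names.  At ρ = punchIn z, the variables of M are
-- used as names unchanged and z is a name that is none of them.
Naming : ℕ → ℕ → Set
Naming n m = Fun.Vector (Fin m) n

_↑_ : (k : ℕ) → Naming n m → Naming n (k + m)
k ↑ ρ = (k ↑ʳ_) ∘ ρ

-- [[M N]]z from P = [[M]]a and Q = [[N]]e; shared by T-App and the
-- applications Nᵢ c in T-Case.
appᴾ : Proc L (2 + m) → Proc L (6 + m) → Fin m → Proc L m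
appᴾ P Q z =
  ν (P ∣ ν (# 3 [ # 0 , 4 ↑ʳ z ] ∣ # 1 ⦅··⦆ Q))

-- [[(M,N)]]z from P = [[M]]e and Q = [[N]]g; shared by T-Pair and the
-- pair (x,y) in T-New.
pairᴾ : Proc L (6 + m) → Proc L (6 + m) → Fin m → Proc L m
pairᴾ P Q z =
  ν ν ((4 ↑ʳ z) [ # 2 , # 0 ] ∣ # 3 ⦅··⦆ P ∣ # 1 ⦅··⦆ Q)

mutual
  ⟦_⟧ᴹ : {Γ : Env L n} {M : Term L n} {T : Ty L} →
         Γ ⊢ᴹ M ∶ T → Naming n m → Fin m → Proc L m
  ⟦ T-Var {x = x} ⟧ᴹ ρ z = ρ x ↔ z
  ⟦ T-Unit ⟧ᴹ ρ z = 𝟎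
  ⟦ T-Abs d ⟧ᴹ ρ z =
    z ⦅··⦆ ν↔ (ν (# 4 [ # 2 , # 0 ])
              ∣ ⟦ d ⟧ᴹ (# 1 Fun.∷ 4 ↑ ρ) (# 3))
  ⟦ T-App d e _ ⟧ᴹ ρ z = appᴾ (⟦ d ⟧ᴹ (2 ↑ ρ) (# 0)) (⟦ e ⟧ᴹ (6 ↑ ρ) (# 0)) z
  ⟦ T-Pair d e _ ⟧ᴹ ρ z = pairᴾ (⟦ d ⟧ᴹ (6 ↑ ρ) (# 0)) (⟦ e ⟧ᴹ (6 ↑ ρ) (# 0)) z
  ⟦ T-Split d e _ ⟧ᴹ ρ z =
    ν (⟦ d ⟧ᴹ (2 ↑ ρ) (# 0)
      ∣ # 1 ⦅··⦆ ν↔ ν↔ (ν (# 6 [ # 4 , # 0 ])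
                       ∣ ν (# 7 [ # 2 , # 0 ])
                       ∣ ⟦ e ⟧ᴹ (# 3 Fun.∷ # 1 Fun.∷ 8 ↑ ρ) (8 ↑ʳ z)))
  ⟦ T-New ⟧ᴹ ρ z =
    ν (ν (# 2 [ # 0 , # 1 ])
      ∣ # 1 ⦅··⦆ ν (pairᴾ ((6 ↑ʳ # 0) ↔ # 0) ((6 ↑ʳ # 1) ↔ # 0) (6 ↑ʳ z)))
  ⟦ T-Spawn d ⟧ᴹ ρ z =
    ν (⟦ d ⟧ᴹ (2 ↑ ρ) (# 0)
      ∣ # 1 ⦅··⦆ (ν (# 2 [ # 0 , # 1 ])
                 ∣ ν (# 3 [ 6 ↑ʳ z , # 0 ])))
  ⟦ T-EndL d _ ⟧ᴹ ρ z = ⟦ d ⟧ᴹ ρ z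
  ⟦ T-EndR ⟧ᴹ ρ z = 𝟎
  ⟦ T-Send d ⟧ᴹ ρ z =
    ν (⟦ d ⟧ᴹ (2 ↑ ρ) (# 0)
      ∣ # 1 ⦅··⦆ ν (ν (# 5 [ # 2 , # 0 ])
                   ∣ ν (# 3 [ # 4 , # 0 ] ∣ # 1 ↔ (8 ↑ʳ z))))
  ⟦ T-Recv d ⟧ᴹ ρ z =
    ν (⟦ d ⟧ᴹ (2 ↑ ρ) (# 0)
      ∣ # 1 ⦅··⦆ ν ((6 ↑ʳ z) [ # 2 , # 0 ] ∣ # 1 ⦅··⦆ (# 5 ↔ # 0)))
  ⟦ T-Select {j = j} d _ ⟧ᴹ ρ z =
    ν (⟦ d ⟧ᴹ (2 ↑ ρ) (# 0)
      ∣ ν (# 3 [ # 0 ]◁ j ∣ # 1 ↔ (4 ↑ʳ z)))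
  ⟦ T-Case d es _ ⟧ᴹ ρ z =
    ν (⟦ d ⟧ᴹ (2 ↑ ρ) (# 0)
      ∣ # 1 ⦅·⦆▷ ⟦ es ⟧ᴹˢ (3 ↑ ρ) (# 0) (3 ↑ʳ z))
  ⟦ T-Sub d e _ ⟧ᴹ ρ z =
    ν↔ (⟦ d ⟧ᴹ (# 0 Fun.∷ 2 ↑ ρ) (2 ↑ʳ z) ∣ ⟦ e ⟧ᴹ (2 ↑ ρ) (# 1))
  ⟦ T-Send′ d e _ ⟧ᴹ ρ z =
    ν (# 0 ⦅··⦆ ⟦ d ⟧ᴹ (4 ↑ ρ) (# 0)
      ∣ ν (⟦ e ⟧ᴹ (4 ↑ ρ) (# 0)
          ∣ ν (# 3 [ # 5 , # 0 ] ∣ # 1 ↔ (6 ↑ʳ z))))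

  -- The family {i : [[Nᵢ c]]z}.
  ⟦_⟧ᴹˢ : ∀ {k} {Δ : Env L n} {Ns : PMap (Term L n) k} {Ss : PMap (STy L) k} {U} →
          Branchwise (λ N S → Δ ⊢ᴹ N ∶ sess S ⊸ U) Ns Ss →
          Naming n m → Fin m → Fin m → PMap (Proc L m) k
  ⟦ [] ⟧ᴹˢ ρ c z = []
  ⟦ MaybeP.nothing ∷ es ⟧ᴹˢ ρ c z = nothing ∷ ⟦ es ⟧ᴹˢ ρ c z
  ⟦ MaybeP.just e ∷ es ⟧ᴹˢ ρ c z =
    just (appᴾ (⟦ e ⟧ᴹ (2 ↑ ρ) (# 0)) ((6 ↑ʳ c) ↔ # 0) z) ∷ ⟦ es ⟧ᴹˢ ρ c z

-- ⟦ b ⟧ᴮ ρ x P is the translation of the buffer on x with continuation P.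
⟦_⟧ᴮ : {Γ : Env L n} {ms : List (Msg L n)} {S′ S : STy L} →
       Γ ⊢ᴮ[ ms ⟩∶ S′ > S → Naming n m → Fin m → Proc L m → Proc L m
⟦ T-Buf ⟧ᴮ ρ x P = P
⟦ T-BufSend d b _ ⟧ᴮ ρ x P =
  ν ν (ν ((6 ↑ʳ x) ↔ # 0 ∣ # 1 [ # 4 , # 2 ])
      ∣ # 3 ⦅··⦆ ⟦ d ⟧ᴹ (6 ↑ ρ) (# 0)
      ∣ ⟦ b ⟧ᴮ (4 ↑ ρ) (# 1) (P under 4 ⟨ # 1 / x ⟩))
⟦ T-BufSelect {j = j} b _ ⟧ᴮ ρ x P =
  ν (ν ((4 ↑ʳ x) ↔ # 0 ∣ # 1 [ # 2 ]◁ j)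
    ∣ ⟦ b ⟧ᴮ (2 ↑ ρ) (# 1) (P under 2 ⟨ # 1 / x ⟩))

⟦_⟧ᶜ : {Γ : Env L n} {φ : Marker} {C : Conf L n} {T : Ty L} →
       Γ ⊢ᶜ⟨ φ ⟩ C ∶ T → Naming n m → Fin m → Proc L m
⟦ T-Main d ⟧ᶜ ρ z = ⟦ d ⟧ᴹ ρ z
⟦ T-Child d ⟧ᶜ ρ z = ⟦ d ⟧ᴹ ρ z
⟦ T-ParL c d _ _ ⟧ᶜ ρ z = ν (⟦ c ⟧ᶜ (2 ↑ ρ) (# 0)) ∣ ⟦ d ⟧ᶜ ρ z
⟦ T-ParR c d _ _ ⟧ᶜ ρ z = ⟦ c ⟧ᶜ ρ z ∣ ν (⟦ d ⟧ᶜ (2 ↑ ρ) (# 0))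
⟦ T-Res b c _ ⟧ᶜ ρ z =
  ν (⟦ b ⟧ᴮ (lift 2 ρ) (# 0) (⟦ c ⟧ᶜ (lift 2 ρ) (2 ↑ʳ z)))
⟦ T-ResBuf b c _ ⟧ᶜ ρ z =
  ν (⟦ b ⟧ᴮ (lift 2 ρ) (# 0) (⟦ c ⟧ᶜ (lift 2 ρ) (2 ↑ʳ z)))
⟦ T-ConfSub c d _ ⟧ᶜ ρ z =
  ν↔ (⟦ c ⟧ᶜ (# 0 Fun.∷ 2 ↑ ρ) (2 ↑ʳ z) ∣ ⟦ d ⟧ᴹ (2 ↑ ρ) (# 1))

{-# OPTIONS --safe #-}
-- The induction is over typing derivations with an arbitrary naming ρ and name z
-- in place of punchIn z and z: if Γ′ is the dual of ⟦ Γ ⟧ᴱ pushed forward along ρ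
-- and Γ′ is disjoint from z, then [[M]]z is typed by Γ′ , z : ⟦ T ⟧ᵀ.  Each clause
-- of the translation then is an explicit cut-based APCP derivation, whose cut
-- formulas match up to dual-involutive; for buffers the substitution P{d/x} is
-- handled by stability of APCP typing under renamings injective on the domain.

module Submission where

open import Defs
open import Data.Fin using (Fin; zero; suc; punchIn; #_; _↑ʳ_; lift)
open import Data.Fin.Properties using (_≟_)
open import Data.List using (List)
open import Data.Maybe as Maybe using (just; nothing)
import Data.Maybe.Relation.Binary.Pointwise as MaybeP
open import Data.Nat using (ℕ; zero; suc; _+_)
open import Data.Product using (_×_; _,_; ∃-syntax)
open import Data.Sum using (_⊎_; inj₁; inj₂)
open import Data.Vec using ([]; _∷_; map; insertAt; lookup; _++_; _[_]=_; here; there)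
import Data.Vec.Functional as Fun
open import Data.Vec.Functional.Properties using (updateAt-updates; updateAt-minimal)
open import Data.Vec.Relation.Binary.Pointwise.Inductive using ([]; _∷_)
open import Function using (_∘_; const; id)
open import Relation.Binary.PropositionalEquality
  using (_≡_; refl; sym; trans; cong; cong₂; subst)
open import Relation.Nullary using (yes; no)

-- A splitting is written cell by cell for the concrete names bound so far
-- (○ neither side, ◂ left, ▸ right), ending in a splitting of the outer names.
pattern ○_ s = none ∷ s
pattern ◂_ s = left ∷ s
pattern ▸_ s = right ∷ s

infixr 5 ○_ ◂_ ▸_

-- Algebra of the partial union of environments.

⊎-comm : {Γ Δ Θ : PMap A n} → Γ ⊎ Δ ≔ Θ → Δ ⊎ Γ ≔ Θ
⊎-comm []    = []
⊎-comm (○ s) = ○ ⊎-comm s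
⊎-comm (◂ s) = ▸ ⊎-comm s
⊎-comm (▸ s) = ◂ ⊎-comm s

-- Union is partial, so rebracketing must supply the new inner union. In the clauses for terms and
-- configurations this hands the result name `z` to the right-hand premise; `⊎-swapʳ` hands it to
-- the left-hand one.
⊎-assoc : {Γ Δ X Ψ Θ : PMap A n} → Γ ⊎ Δ ≔ X → X ⊎ Ψ ≔ Θ →
          ∃[ Y ] Δ ⊎ Ψ ≔ Y × Γ ⊎ Y ≔ Θ
⊎-assoc []    []    = [] , [] , []
⊎-assoc (○ s) (○ t) = let _ , p , q = ⊎-assoc s t in _ , ○ p , ○ q
⊎-assoc (○ s) (▸ t) = let _ , p , q = ⊎-assoc s t in _ , ▸ p , ▸ q
⊎-assoc (◂ s) (◂ t) = let _ , p , q = ⊎-assoc s t in _ , ○ p , ◂ q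
⊎-assoc (▸ s) (◂ t) = let _ , p , q = ⊎-assoc s t in _ , ◂ p , ▸ q

⊎-assoc˘ : {Γ Δ Y Ψ Θ : PMap A n} → Γ ⊎ Y ≔ Θ → Δ ⊎ Ψ ≔ Y →
           ∃[ X ] Γ ⊎ Δ ≔ X × X ⊎ Ψ ≔ Θ
⊎-assoc˘ s t =
  let _ , p , q = ⊎-assoc (⊎-comm t) (⊎-comm s) in _ , ⊎-comm p , ⊎-comm q

⊎-swapʳ : {Γ Δ X Ψ Θ : PMap A n} → Γ ⊎ Δ ≔ X → X ⊎ Ψ ≔ Θ →
          ∃[ Y ] Γ ⊎ Ψ ≔ Y × Y ⊎ Δ ≔ Θ
⊎-swapʳ s t =
  let _ , p , q = ⊎-assoc s t in ⊎-assoc˘ q (⊎-comm p)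

⊎-∅ʳ : {Γ : PMap A n} → Γ ⊎ ∅ ≔ Γ
⊎-∅ʳ {Γ = []}          = []
⊎-∅ʳ {Γ = just _ ∷ _}  = ◂ ⊎-∅ʳ
⊎-∅ʳ {Γ = nothing ∷ _} = ○ ⊎-∅ʳ

⊎-new : {Γ : PMap A n} {a : A} → nothing ∷ Γ ⊎ [ zero ∶ a ] ≔ just a ∷ Γ
⊎-new = ▸ ⊎-∅ʳ

⊎-∅ˡ : {Γ : PMap A n} → ∅ ⊎ Γ ≔ Γ
⊎-∅ˡ = ⊎-comm ⊎-∅ʳ

⊎-functional : {Γ Δ Θ Θ′ : PMap A n} → Γ ⊎ Δ ≔ Θ → Γ ⊎ Δ ≔ Θ′ → Θ ≡ Θ′
⊎-functional []    []    = refl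
⊎-functional (○ s) (○ t) = cong (_ ∷_) (⊎-functional s t)
⊎-functional (◂ s) (◂ t) = cong (_ ∷_) (⊎-functional s t)
⊎-functional (▸ s) (▸ t) = cong (_ ∷_) (⊎-functional s t)

⊎-map : {A B : Set} {Γ Δ Θ : PMap A n} (f : A → B) → Γ ⊎ Δ ≔ Θ →
        map (Maybe.map f) Γ ⊎ map (Maybe.map f) Δ ≔ map (Maybe.map f) Θ
⊎-map f []    = []
⊎-map f (○ s) = ○ ⊎-map f s
⊎-map f (◂ s) = ◂ ⊎-map f s
⊎-map f (▸ s) = ▸ ⊎-map f s

⊎-single-fresh : ∀ {Γ Θ : PMap A n} x {a} → Γ ⊎ [ x ∶ a ] ≔ Θ → lookup Γ x ≡ nothing
⊎-single-fresh zero    (▸ _) = refl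
⊎-single-fresh (suc x) (○ s) = ⊎-single-fresh x s
⊎-single-fresh (suc x) (◂ s) = ⊎-single-fresh x s

⊎-insertAt : ∀ (Γ : PMap A n) z {a} → insertAt Γ z nothing ⊎ [ z ∶ a ] ≔ Γ ,[ z ∶ a ]
⊎-insertAt Γ             zero    = ▸ ⊎-∅ʳ
⊎-insertAt (just _ ∷ Γ)  (suc z) = ◂ ⊎-insertAt Γ z
⊎-insertAt (nothing ∷ Γ) (suc z) = ○ ⊎-insertAt Γ z

⊎-insertAt-nothing : {Γ Δ Θ : PMap A n} (z : Fin (suc n)) → Γ ⊎ Δ ≔ Θ →
  insertAt Γ z nothing ⊎ insertAt Δ z nothing ≔ insertAt Θ z nothing
⊎-insertAt-nothing zero    s       = ○ s
⊎-insertAt-nothing (suc z) (c ∷ s) = c ∷ ⊎-insertAt-nothing z s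

map-∅ : {A B : Set} (f : A → B) → map (Maybe.map f) (∅ {n = n}) ≡ ∅
map-∅ {n = zero}  f = refl
map-∅ {n = suc n} f = cong (nothing ∷_) (map-∅ f)

map-single : {A B : Set} (f : A → B) (x : Fin n) {a : A} →
             map (Maybe.map f) [ x ∶ a ] ≡ [ x ∶ f a ]
map-single f zero    = cong (_ ∷_) (map-∅ f)
map-single f (suc x) = cong (nothing ∷_) (map-single f x)

-- Pushing environments forward along renamings.

infix 4 _↪[_]_

-- Γ ↪[ ρ ] Θ : Θ is Γ with its names renamed by ρ.  Asking each new name to be
-- disjoint from the rest makes ρ injective on the domain of Γ and only there,
-- so that names outside the domain may clash (as x does in T-Res).
data _↪[_]_ {A : Set} {m : ℕ} : ∀ {n} → PMap A n → Naming n m → PMap A m → Set where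
  []   : {ρ : Naming 0 m} → [] ↪[ ρ ] ∅
  skip : ∀ {n} {Γ : PMap A n} {ρ : Naming (suc n) m} {Θ} →
         Γ ↪[ ρ ∘ suc ] Θ → nothing ∷ Γ ↪[ ρ ] Θ
  keep : ∀ {n} {Γ : PMap A n} {ρ : Naming (suc n) m} {a Θ Θ′} →
         Γ ↪[ ρ ∘ suc ] Θ → Θ ⊎ [ ρ zero ∶ a ] ≔ Θ′ → just a ∷ Γ ↪[ ρ ] Θ′

↪-∅ : {ρ : Naming n m} → ∅ {A = A} ↪[ ρ ] ∅
↪-∅ {n = zero}  = []
↪-∅ {n = suc n} = skip ↪-∅

↪-∅⁻¹ : {ρ : Naming n m} {Θ : PMap A m} → ∅ ↪[ ρ ] Θ → Θ ≡ ∅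
↪-∅⁻¹ {n = zero}  []       = refl
↪-∅⁻¹ {n = suc n} (skip e) = ↪-∅⁻¹ e

↪-single : {ρ : Naming n m} (x : Fin n) {a : A} → [ x ∶ a ] ↪[ ρ ] [ ρ x ∶ a ]
↪-single zero    = keep ↪-∅ ⊎-∅ˡ
↪-single (suc x) = skip (↪-single x)

↪-single⁻¹ : {ρ : Naming n m} (x : Fin n) {a : A} {Θ : PMap A m} →
             [ x ∶ a ] ↪[ ρ ] Θ → Θ ≡ [ ρ x ∶ a ]
↪-single⁻¹ zero (keep e s) with refl ← ↪-∅⁻¹ e = ⊎-functional s ⊎-∅ˡ
↪-single⁻¹ (suc x) (skip e) = ↪-single⁻¹ x e

↪-suc : {ρ : Naming n m} {Γ : PMap A n} {Θ : PMap A m} →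
        Γ ↪[ ρ ] Θ → Γ ↪[ suc ∘ ρ ] nothing ∷ Θ
↪-suc []         = []
↪-suc (skip e)   = skip (↪-suc e)
↪-suc (keep e s) = keep (↪-suc e) (○ s)

↪-↑ : ∀ k {ρ : Naming n m} {Γ : PMap A n} {Θ : PMap A m} →
      Γ ↪[ ρ ] Θ → Γ ↪[ k ↑ ρ ] ∅ {n = k} ++ Θ
↪-↑ zero    e = e
↪-↑ (suc k) e = ↪-suc (↪-↑ k e)

↪-lift : ∀ c {ρ : Naming n m} {Γ : PMap A n} {Θ : PMap A m} →
         Γ ↪[ ρ ] Θ → c ∷ Γ ↪[ lift 1 ρ ] c ∷ Θ
↪-lift nothing  e = skip (↪-suc e)
↪-lift (just a) e = keep (↪-suc e) (▸ ⊎-∅ʳ)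

-- `lift 2 ρ` and `lift 1 (lift 1 ρ)` agree only pointwise, so iterating `↪-lift` does not give
-- this.
↪-lift₂ : ∀ b c {ρ : Naming n m} {Γ : PMap A n} {Θ : PMap A m} →
          Γ ↪[ ρ ] Θ → b ∷ c ∷ Γ ↪[ lift 2 ρ ] b ∷ c ∷ Θ
↪-lift₂ nothing  nothing  e = skip (skip (↪-↑ 2 e))
↪-lift₂ nothing  (just _) e = skip (keep (↪-↑ 2 e) (○ ▸ ⊎-∅ʳ))
↪-lift₂ (just _) nothing  e = keep (skip (↪-↑ 2 e)) (▸ ○ ⊎-∅ʳ)
↪-lift₂ (just _) (just _) e = keep (keep (↪-↑ 2 e) (○ ▸ ⊎-∅ʳ)) (▸ ◂ ⊎-∅ʳ)

-- Both `id ∘ suc` and `punchIn zero` are `suc`, so `↪-id` and `↪-punchIn` rest on this shift.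
↪-suc-id : (Γ : PMap A n) → Γ ↪[ suc ] nothing ∷ Γ
↪-suc-id []            = []
↪-suc-id (nothing ∷ Γ) = skip (↪-suc (↪-suc-id Γ))
↪-suc-id (just a ∷ Γ)  = keep (↪-suc (↪-suc-id Γ)) (○ ▸ ⊎-∅ʳ)

↪-id : (Γ : PMap A n) → Γ ↪[ id ] Γ
↪-id []            = []
↪-id (nothing ∷ Γ) = skip (↪-suc-id Γ)
↪-id (just a ∷ Γ)  = keep (↪-suc-id Γ) (▸ ⊎-∅ʳ)

↪-punchIn : (Γ : PMap A n) (z : Fin (suc n)) → Γ ↪[ punchIn z ] insertAt Γ z nothing
↪-punchIn Γ             zero    = ↪-suc-id Γ
↪-punchIn (nothing ∷ Γ) (suc z) = skip (↪-suc (↪-punchIn Γ z))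
↪-punchIn (just a ∷ Γ)  (suc z) = keep (↪-suc (↪-punchIn Γ z)) (▸ ⊎-∅ʳ)

-- Agreement is asked only on the domain because a substitution for `x` agrees with weakening only
-- away from `x`.
↪-cong : {ρ σ : Naming n m} {Γ : PMap A n} {Θ : PMap A m} →
         (∀ x → lookup Γ x ≡ nothing ⊎ ρ x ≡ σ x) → Γ ↪[ ρ ] Θ → Γ ↪[ σ ] Θ
↪-cong eq []       = []
↪-cong eq (skip e) = skip (↪-cong (eq ∘ suc) e)
↪-cong eq (keep e s) with inj₂ p ← eq zero =
  keep (↪-cong (eq ∘ suc) e) (subst (λ x → _ ⊎ [ x ∶ _ ] ≔ _) p s)

↪-split : {ρ : Naming n m} {Γ Δ Θ : PMap A n} {Θ′ : PMap A m} →
  Γ ⊎ Δ ≔ Θ → Θ ↪[ ρ ] Θ′ →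
  ∃[ Γ′ ] ∃[ Δ′ ] Γ ↪[ ρ ] Γ′ × Δ ↪[ ρ ] Δ′ × Γ′ ⊎ Δ′ ≔ Θ′
↪-split [] [] = ∅ , ∅ , [] , [] , ⊎-∅ʳ
↪-split (○ s) (skip e) =
  let _ , _ , p , q , t = ↪-split s e in _ , _ , skip p , skip q , t
↪-split (◂ s) (keep e u) =
  let _ , _ , p , q , t = ↪-split s e
      _ , v , w = ⊎-swapʳ t u
  in _ , _ , keep p v , skip q , w
↪-split (▸ s) (keep e u) =
  let _ , _ , p , q , t = ↪-split s e
      _ , v , w = ⊎-assoc t u
  in _ , _ , skip p , keep q v , w

-- Lets a renaming be checked separately on disjoint parts of its domain, as for a substitution,
-- which treats `x` differently from the other names.
↪-join : {ρ : Naming n m} {Γ Δ Θ : PMap A n} {Γ′ Δ′ Θ′ : PMap A m} →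
  Γ ↪[ ρ ] Γ′ → Δ ↪[ ρ ] Δ′ → Γ ⊎ Δ ≔ Θ → Γ′ ⊎ Δ′ ≔ Θ′ → Θ ↪[ ρ ] Θ′
↪-join [] [] [] t = subst ([] ↪[ _ ]_) (⊎-functional ⊎-∅ʳ t) []
↪-join (skip p)   (skip q)   (○ s) t = skip (↪-join p q s t)
↪-join (keep p u) (skip q)   (◂ s) t =
  let _ , v , w = ⊎-swapʳ u t in keep (↪-join p q s v) w
↪-join (skip p)   (keep q u) (▸ s) t =
  let _ , v , w = ⊎-assoc˘ t u in keep (↪-join p q s v) w

↪-split-singles : {ρ : Naming n m} (x y : Fin n) {a b : A} {Θ : PMap A n} {Θ′ : PMap A m} →
  [ x ∶ a ] ⊎ [ y ∶ b ] ≔ Θ → Θ ↪[ ρ ] Θ′ → [ ρ x ∶ a ] ⊎ [ ρ y ∶ b ] ≔ Θ′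
↪-split-singles x y s e with ↪-split s e
... | _ , _ , p , q , t with refl ← ↪-single⁻¹ x p | refl ← ↪-single⁻¹ y q = t

↪-split-single : {ρ : Naming n m} (x : Fin n) {a : A} {Γ Θ : PMap A n} {Θ′ : PMap A m} →
  Γ ⊎ [ x ∶ a ] ≔ Θ → Θ ↪[ ρ ] Θ′ →
  ∃[ Γ′ ] Γ ↪[ ρ ] Γ′ × Γ′ ⊎ [ ρ x ∶ a ] ≔ Θ′
↪-split-single x s e with ↪-split s e
... | _ , _ , p , q , t with refl ← ↪-single⁻¹ x q = _ , p , t

-- Stability of APCP typing under renaming.

mutual
  -- Induction on the derivation: `↪-split` transports each division of the context, and the lifting
  -- lemmas pass under binders.
  ⊢-rename : {P : Proc L n} {Γ : Ctx L n} {ρ : Naming n m} {Θ : Ctx L m} →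
             P ⊢* Γ → Γ ↪[ ρ ] Θ → rename ρ P ⊢* Θ
  ⊢-rename ⊢𝟎 e with refl ← ↪-∅⁻¹ e = ⊢𝟎
  ⊢-rename (⊢● p s) e =
    let _ , e′ , t = ↪-split-single _ s e in ⊢● (⊢-rename p e′) t
  ⊢-rename (⊢↔ s) e = ⊢↔ (↪-split-singles _ _ s e)
  ⊢-rename (⊢∣ p q s) e =
    let _ , _ , e₁ , e₂ , t = ↪-split s e
    in ⊢∣ (⊢-rename p e₁) (⊢-rename q e₂) t
  ⊢-rename (⊢ν p) e = ⊢ν (⊢-rename p (↪-lift₂ _ _ e))
  ⊢-rename (⊢⊗ s t) e =
    let _ , e′ , u = ↪-split-single _ t e in ⊢⊗ (↪-split-singles _ _ s e′) u
  ⊢-rename (⊢⅋ p s) e =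
    let _ , e′ , t = ↪-split-single _ s e in ⊢⅋ (⊢-rename p (↪-lift₂ _ _ e′)) t
  ⊢-rename (⊢⊕ j s) e = ⊢⊕ j (↪-split-singles _ _ s e)
  ⊢-rename (⊢& ps s) e =
    let _ , e′ , t = ↪-split-single _ s e in ⊢& (⊢-renames ps e′) t

  ⊢-renames : ∀ {k} {Ps : PMap (Proc L (suc n)) k} {As : PMap (AType L) k}
              {Γ : Ctx L n} {ρ : Naming n m} {Θ : Ctx L m} →
              Branchwise (λ P A → P ⊢* just A ∷ Γ) Ps As → Γ ↪[ ρ ] Θ →
              Branchwise (λ P A → P ⊢* just A ∷ Θ) (renames (lift 1 ρ) Ps) As
  ⊢-renames []                    e = []
  ⊢-renames (MaybeP.nothing ∷ ps) e = MaybeP.nothing ∷ ⊢-renames ps e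
  ⊢-renames (MaybeP.just p ∷ ps)  e =
    MaybeP.just (⊢-rename p (↪-lift _ e)) ∷ ⊢-renames ps e

-- Duality and the translation of types.

mutual
  dual-involutive : (A : AType L) → dual (dual A) ≡ A
  dual-involutive (A ⊗ B) = cong₂ _⊗_ (dual-involutive A) (dual-involutive B)
  dual-involutive (A ⅋ B) = cong₂ _⅋_ (dual-involutive A) (dual-involutive B)
  dual-involutive (⊕ As)  = cong ⊕ (duals-involutive As)
  dual-involutive (& As)  = cong & (duals-involutive As)
  dual-involutive ●       = refl

  duals-involutive : (As : PMap (AType L) n) → duals (duals As) ≡ As
  duals-involutive []             = refl
  duals-involutive (nothing ∷ As) = cong (nothing ∷_) (duals-involutive As)
  duals-involutive (just A ∷ As)  =
    cong₂ (λ B Bs → just B ∷ Bs) (dual-involutive A) (duals-involutive As)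

mutual
  -- The translation of `!` already dualizes its payload, so the `!` clause must cancel a double
  -- dual; for `¿` the payloads agree by computation.
  ⟦dual⟧ : (S : STy L) → ⟦ dualˢ S ⟧ˢ ≡ dual ⟦ S ⟧ˢ
  ⟦dual⟧ (! T ∙ S) =
    cong₂ (λ A B → (A ⅋ ●) ⊗ B) (sym (dual-involutive ⟦ T ⟧ᵀ)) (⟦dual⟧ S)
  ⟦dual⟧ (¿ T ∙ S) = cong (_ ⅋_) (⟦dual⟧ S)
  ⟦dual⟧ (⊕ Ss)    = cong ⊕ (⟦duals⟧ Ss)
  ⟦dual⟧ (& Ss)    = cong & (⟦duals⟧ Ss)
  ⟦dual⟧ end       = refl

  ⟦duals⟧ : (Ss : PMap (STy L) n) → ⟦ dualsˢ Ss ⟧ˢˢ ≡ duals ⟦ Ss ⟧ˢˢ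
  ⟦duals⟧ []             = refl
  ⟦duals⟧ (nothing ∷ Ss) = cong (nothing ∷_) (⟦duals⟧ Ss)
  ⟦duals⟧ (just S ∷ Ss)  = cong₂ (λ A As → just A ∷ As) (⟦dual⟧ S) (⟦duals⟧ Ss)

duals-lookup : ∀ {As : PMap (AType L) n} {j B} →
               As [ j ]= just B → duals As [ j ]= just (dual B)
duals-lookup here                           = here
duals-lookup {As = nothing ∷ _} (there j) = there (duals-lookup j)
duals-lookup {As = just _ ∷ _}  (there j) = there (duals-lookup j)

⟦⟧-lookup : ∀ {Ss : PMap (STy L) n} {j S} →
            Ss [ j ]= just S → ⟦ Ss ⟧ˢˢ [ j ]= just ⟦ S ⟧ˢ
⟦⟧-lookup here                         = here
⟦⟧-lookup {Ss = nothing ∷ _} (there j) = there (⟦⟧-lookup j)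
⟦⟧-lookup {Ss = just _ ∷ _}  (there j) = there (⟦⟧-lookup j)

-- Derived APCP typing rules.

-- `dual` is involutive only propositionally; with the equation as an argument, each cut can state
-- both ends without double duals. `⊢⊗′` does the same for outputs.
⊢ν′ : ∀ {a A B} {P : Proc L (2 + n)} {Γ : Ctx L n} → B ≡ dual A →
      P ⊢* just A ∷ just B ∷ Γ → ν[ a ] P ⊢* Γ
⊢ν′ refl p = ⊢ν p

⊢⊗′ : ∀ {x y z : Fin n} {A B A′ B′} {Γ Θ : Ctx L n} → A′ ≡ dual A → B′ ≡ dual B →
      [ x ∶ A ⊗ B ] ⊎ [ y ∶ A′ ] ≔ Γ → Γ ⊎ [ z ∶ B′ ] ≔ Θ →
      x [ y , z ] ⊢* Θ
⊢⊗′ refl refl s t = ⊢⊗ s t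

-- The second received name is a dummy continuation, introduced by weakening at `●`.
⊢⅋● : ∀ {x : Fin n} {P A} {Γ Θ : Ctx L n} →
      P ⊢* just A ∷ nothing ∷ Γ → Γ ⊎ [ x ∶ A ⅋ ● ] ≔ Θ →
      x ⦅··⦆ P ⊢* Θ
⊢⅋● p s = ⊢⅋ (⊢● {x = # 1} p (◂ ▸ ⊎-∅ʳ)) s

⊢⊗● : ∀ {x y : Fin n} {A} {Θ : Ctx L n} →
      [ x ∶ dual A ⊗ ● ] ⊎ [ y ∶ A ] ≔ Θ →
      ν ((2 ↑ʳ x) [ 2 ↑ʳ y , # 0 ]) ⊢* Θ
⊢⊗● {A = A} s =
  ⊢ν (⊢● {x = # 1} (⊢⊗′ (sym (dual-involutive A)) refl (○ ○ s) (▸ ○ ⊎-∅ʳ)) (◂ ▸ ⊎-∅ʳ))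

-- In the context of `Q`, cell 0 is `e` and the five empty cells are `f`, `c`, `d`, `a`, `b`.
⊢app : ∀ {P Q} {A B} {z : Fin n} {Γ Δ Θ Ξ : Ctx L n} →
  P ⊢* just ((dual A ⊗ ●) ⅋ B) ∷ nothing ∷ Γ →
  Q ⊢* just A ∷ (∅ {n = 5} ++ Δ) →
  Γ ⊎ Δ ≔ Θ → Θ ⊎ [ z ∶ B ] ≔ Ξ →
  appᴾ P Q z ⊢* Ξ
⊢app {A = A} {B} p q s t =
  let _ , u , v = ⊎-assoc s t
      inv       = cong (_⅋ ●) (sym (dual-involutive A))
  in ⊢ν′ (cong (_⊗ dual B) inv)
       (⊢∣ p
         (⊢ν′ inv
           (⊢∣ (⊢⊗′ refl (sym (dual-involutive B)) (▸ ○ ○ ◂ ⊎-∅ʳ) (◂ ○ ○ ◂ ⊎-∅ˡ))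
               (⊢⅋● q (○ ▸ ○ ○ ⊎-∅ʳ))
               (◂ ▸ ○ ◂ ⊎-comm u)))
         (◂ ▸ v))

⊢pair : ∀ {P Q} {A B} {z : Fin n} {Γ Δ Θ Ξ : Ctx L n} →
  P ⊢* just A ∷ (∅ {n = 5} ++ Γ) →
  Q ⊢* just B ∷ (∅ {n = 5} ++ Δ) →
  Γ ⊎ Δ ≔ Θ → Θ ⊎ [ z ∶ (A ⅋ ●) ⊗ (B ⅋ ●) ] ≔ Ξ →
  pairᴾ P Q z ⊢* Ξ
⊢pair {A = A} {B} p q s t =
  ⊢ν′ (cong (_⅋ ●) (sym (dual-involutive A)))
    (⊢ν′ (cong (_⅋ ●) (sym (dual-involutive B)))
      (⊢∣ (⊢⊗ (○ ○ ▸ ○ ⊎-∅ʳ) (▸ ○ ◂ ○ ⊎-∅ʳ))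
          (⊢∣ (⊢⅋● p (○ ○ ○ ▸ ⊎-∅ʳ)) (⊢⅋● q (○ ▸ ○ ○ ⊎-∅ʳ)) (○ ▸ ○ ◂ s))
          (◂ ▸ ◂ ▸ ⊎-comm t)))

-- Dualized translations of environments.

⟦_⟧⊥ : Env L n → Ctx L n
⟦ Γ ⟧⊥ = dualᴱ ⟦ Γ ⟧ᴱ

⟦⟧⊥-⊎ : {Γ Δ Θ : Env L n} → Γ ⊎ Δ ≔ Θ → ⟦ Γ ⟧⊥ ⊎ ⟦ Δ ⟧⊥ ≔ ⟦ Θ ⟧⊥
⟦⟧⊥-⊎ s = ⊎-map dual (⊎-map ⟦_⟧ᵀ s)

⟦⟧⊥-∅ : ⟦ ∅ {A = Ty L} {n = n} ⟧⊥ ≡ ∅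
⟦⟧⊥-∅ = trans (cong dualᴱ (map-∅ ⟦_⟧ᵀ)) (map-∅ dual)

⟦⟧⊥-single : ∀ (x : Fin n) {T : Ty L} → ⟦ [ x ∶ T ] ⟧⊥ ≡ [ x ∶ dual ⟦ T ⟧ᵀ ]
⟦⟧⊥-single x = trans (cong dualᴱ (map-single ⟦_⟧ᵀ x)) (map-single dual x)

↪-⟦∅⟧⊥ : {ρ : Naming n m} {Γ′ : Ctx L m} → ⟦ ∅ {n = n} ⟧⊥ ↪[ ρ ] Γ′ → Γ′ ≡ ∅
↪-⟦∅⟧⊥ e = ↪-∅⁻¹ (subst (_↪[ _ ] _) ⟦⟧⊥-∅ e)

↪-⟦single⟧⊥ : ∀ (x : Fin n) {T} {ρ : Naming n m} {Γ′ : Ctx L m} →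
              ⟦ [ x ∶ T ] ⟧⊥ ↪[ ρ ] Γ′ → Γ′ ≡ [ ρ x ∶ dual ⟦ T ⟧ᵀ ]
↪-⟦single⟧⊥ x e = ↪-single⁻¹ x (subst (_↪[ _ ] _) (⟦⟧⊥-single x) e)

-- Typing of translated terms.

mutual
  ⊢ᴹ : {Γ : Env L n} {M : Term L n} {T : Ty L} {ρ : Naming n m} {z : Fin m}
       {Γ′ Θ : Ctx L m} (d : Γ ⊢ᴹ M ∶ T) →
       ⟦ Γ ⟧⊥ ↪[ ρ ] Γ′ → Γ′ ⊎ [ z ∶ ⟦ T ⟧ᵀ ] ≔ Θ →
       ⟦ d ⟧ᴹ ρ z ⊢* Θ
  ⊢ᴹ (T-Var {x = x}) e s with refl ← ↪-⟦single⟧⊥ x e = ⊢↔ s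
  ⊢ᴹ T-Unit e s with refl ← ↪-⟦∅⟧⊥ e = ⊢● ⊢𝟎 s
  ⊢ᴹ (T-Abs d) e s =
    ⊢⅋ (⊢ν (⊢∣ (⊢⊗● (▸ ○ ◂ ○ ⊎-∅ʳ))
               (⊢ᴹ d (keep (↪-↑ 4 e) (○ ▸ ○ ○ ⊎-∅ʳ)) (○ ◂ ○ ▸ ⊎-∅ʳ))
               (◂ ▸ ◂ ▸ ⊎-∅ˡ)))
       s
  ⊢ᴹ (T-App d d′ u) e s =
    let _ , _ , e₁ , e₂ , t = ↪-split (⟦⟧⊥-⊎ u) e
    in ⊢app (⊢ᴹ d (↪-↑ 2 e₁) ⊎-new) (⊢ᴹ d′ (↪-↑ 6 e₂) ⊎-new) t s
  ⊢ᴹ (T-Pair d d′ u) e s =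
    let _ , _ , e₁ , e₂ , t = ↪-split (⟦⟧⊥-⊎ u) e
    in ⊢pair (⊢ᴹ d (↪-↑ 6 e₁) ⊎-new) (⊢ᴹ d′ (↪-↑ 6 e₂) ⊎-new) t s
  ⊢ᴹ (T-Split d d′ u) e s =
    let _ , _ , e₁ , e₂ , t = ↪-split (⟦⟧⊥-⊎ u) e
        _ , v , w           = ⊎-assoc t s
    in ⊢ν (⊢∣ (⊢ᴹ d (↪-↑ 2 e₁) ⊎-new)
              (⊢⅋ (⊢ν (⊢ν (⊢∣ (⊢⊗● (○ ○ ▸ ○ ◂ ○ ○ ○ ⊎-∅ʳ))
                      (⊢∣ (⊢⊗● (▸ ○ ○ ○ ○ ◂ ○ ○ ⊎-∅ʳ))
                          -- The inner `keep` places `T′` at `y`, which is `# 1`; the outer one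
                          -- places `T` at `x`, which is `# 3`.
                          (⊢ᴹ d′ (keep (keep (↪-↑ 8 e₂) (○ ▸ ○ ○ ○ ○ ○ ○ ⊎-∅ʳ))
                                       (○ ◂ ○ ▸ ○ ○ ○ ○ ⊎-∅ʳ))
                                 (○ ◂ ○ ◂ ○ ○ ○ ○ v))
                          (◂ ▸ ○ ▸ ○ ◂ ○ ○ ⊎-∅ˡ))
                      (▸ ▸ ◂ ▸ ◂ ▸ ○ ○ ⊎-∅ˡ))))
                  (○ ▸ ⊎-∅ʳ))
              (◂ ▸ w))
  ⊢ᴹ (T-New {S = S}) e s with refl ← ↪-⟦∅⟧⊥ e =
    -- Both ends of one channel are sent, which the self-dual `●` permits.
    ⊢ν (⊢∣ (⊢ν (⊢⊗ {A = ●} {●} (▸ ○ ◂ ○ ⊎-∅ʳ) (◂ ▸ ◂ ○ ⊎-∅ʳ)))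
           (⊢⅋ (⊢● {x = # 1} (⊢● {x = # 0} (⊢ν′ (cong dual (⟦dual⟧ S))
                   (⊢pair (⊢↔ (▸ ○ ○ ○ ○ ○ ◂ ○ ○ ○ ○ ○ ⊎-∅ʳ))
                          (⊢↔ (▸ ○ ○ ○ ○ ○ ○ ◂ ○ ○ ○ ○ ⊎-∅ʳ))
                          (◂ ▸ ○ ○ ○ ○ ⊎-∅ʳ)
                          (◂ ◂ ○ ○ ○ ○ s)))
                   (▸ ○ ○ ○ ⊎-∅ʳ)) (◂ ▸ ○ ○ ⊎-∅ʳ))
               (○ ▸ ⊎-∅ʳ))
           (◂ ▸ ⊎-∅ˡ))
  ⊢ᴹ (T-Spawn d) e s =
    ⊢ν (⊢∣ (⊢ᴹ d (↪-↑ 2 e) ⊎-new)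
           (⊢⅋ (⊢∣ (⊢ν (⊢⊗ {A = ●} {●} (▸ ○ ◂ ○ ⊎-∅ʳ) (◂ ▸ ◂ ○ ⊎-∅ʳ)))
                   (⊢⊗● (○ ◂ ○ ○ ⊎-∅ˡ))
                   (◂ ▸ ○ ○ ⊎-∅ˡ))
               (○ ▸ ⊎-∅ʳ))
           (◂ ▸ s))
  ⊢ᴹ (T-EndL {x = x} d u) e s with ↪-split (⟦⟧⊥-⊎ u) e
  ... | _ , _ , e₁ , e₂ , t with refl ← ↪-⟦single⟧⊥ x e₂ =
    -- `end` translates to `●`, its own dual, so the extra variable enters by weakening.
    let _ , v , w = ⊎-swapʳ t s in ⊢● (⊢ᴹ d e₁ v) w
  ⊢ᴹ T-EndR e s with refl ← ↪-⟦∅⟧⊥ e = ⊢● ⊢𝟎 s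
  ⊢ᴹ (T-Send {T = T} {S} d) e s =
    ⊢ν (⊢∣ (⊢ᴹ d (↪-↑ 2 e) ⊎-new)
           -- Sending `c` gives `f` the payload `⟦ T ⟧ᵀ ⅋ ●`, while dualizing the type of `e` gives
           -- `dual (dual ⟦ T ⟧ᵀ) ⅋ ●`.
           (⊢⅋ (⊢ν′ (cong (λ A → (A ⅋ ●) ⊗ dual ⟦ S ⟧ˢ) (sym (dual-involutive ⟦ T ⟧ᵀ)))
                 (⊢∣ (⊢⊗● (▸ ○ ○ ◂ ○ ○ ⊎-∅ʳ))
                     (⊢ν (⊢∣ (⊢⊗′ refl (sym (dual-involutive ⟦ S ⟧ˢ))
                                (○ ○ ○ ◂ ▸ ○ ○ ○ ⊎-∅ʳ) (▸ ○ ○ ◂ ◂ ○ ○ ○ ⊎-∅ʳ))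
                             (⊢↔ (○ ◂ ○ ○ ○ ○ ○ ○ ⊎-∅ˡ))
                             (◂ ▸ ○ ◂ ◂ ○ ○ ○ ⊎-∅ˡ)))
                     (◂ ▸ ▸ ◂ ○ ○ ⊎-∅ˡ)))
               (○ ▸ ⊎-∅ʳ))
           (◂ ▸ s))
  ⊢ᴹ (T-Recv {S = S} d) e s =
    ⊢ν (⊢∣ (⊢ᴹ d (↪-↑ 2 e) ⊎-new)
           (⊢⅋ (⊢ν′ (cong (_⅋ ●) (sym (dual-involutive ⟦ S ⟧ˢ)))
                 (⊢∣ (⊢⊗ (○ ○ ▸ ○ ○ ○ ⊎-∅ʳ) (▸ ○ ◂ ○ ○ ○ ⊎-∅ʳ))
                     (⊢⅋● (⊢↔ (▸ ○ ○ ○ ○ ◂ ○ ○ ⊎-∅ʳ)) (○ ▸ ○ ◂ ○ ○ ⊎-∅ʳ))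
                     (◂ ▸ ◂ ▸ ○ ○ ⊎-∅ʳ)))
               (○ ▸ ⊎-∅ʳ))
           (◂ ▸ s))
  ⊢ᴹ (T-Select {S = S} d j) e s =
    ⊢ν (⊢∣ (⊢ᴹ d (↪-↑ 2 e) ⊎-new)
           -- Selection types `c` by `dual (dual ⟦ S ⟧ˢ)` and the forwarder types `d` by
           -- `dual ⟦ S ⟧ˢ`.
           (⊢ν′ (sym (dual-involutive (dual ⟦ S ⟧ˢ)))
             (⊢∣ (⊢⊕ (duals-lookup (⟦⟧-lookup j)) (▸ ○ ○ ◂ ⊎-∅ʳ))
                 (⊢↔ (○ ◂ ○ ○ ⊎-∅ˡ))
                 (◂ ▸ ○ ◂ ⊎-∅ˡ)))
           (◂ ▸ s))
  ⊢ᴹ (T-Case d ds u) e s =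
    let _ , _ , e₁ , e₂ , t = ↪-split (⟦⟧⊥-⊎ u) e
        _ , v , w           = ⊎-assoc t s
    in ⊢ν (⊢∣ (⊢ᴹ d (↪-↑ 2 e₁) ⊎-new)
              (⊢& (⊢ᴹˢ ds (↪-↑ 2 e₂) (○ ○ v)) (○ ▸ ⊎-∅ʳ))
              (◂ ▸ w))
  ⊢ᴹ (T-Sub {T = T} d d′ u) e s =
    let _ , _ , e₁ , e₂ , t = ↪-split (⟦⟧⊥-⊎ u) e
        _ , v , w           = ⊎-swapʳ t s
    in ⊢ν′ (sym (dual-involutive ⟦ T ⟧ᵀ))
         (⊢∣ (⊢ᴹ d (keep (↪-↑ 2 e₁) (▸ ○ ⊎-∅ʳ)) (◂ ○ v))
             (⊢ᴹ d′ (↪-↑ 2 e₂) (○ ▸ ⊎-∅ʳ))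
             (◂ ▸ w))
  ⊢ᴹ (T-Send′ {T = T} {S} d d′ u) e s =
    let _ , _ , e₁ , e₂ , t = ↪-split (⟦⟧⊥-⊎ u) e
        _ , v , w           = ⊎-assoc t s
    in ⊢ν (⊢∣ (⊢⅋● (⊢ᴹ d (↪-↑ 4 e₁) ⊎-new) (▸ ○ ⊎-∅ʳ))
              (⊢ν′ (cong (λ A → (A ⅋ ●) ⊗ dual ⟦ S ⟧ˢ) (sym (dual-involutive ⟦ T ⟧ᵀ)))
                (⊢∣ (⊢ᴹ d′ (↪-↑ 4 e₂) ⊎-new)
                    (⊢ν (⊢∣ (⊢⊗′ refl (sym (dual-involutive ⟦ S ⟧ˢ))
                               (○ ○ ○ ◂ ○ ▸ ⊎-∅ʳ) (▸ ○ ○ ◂ ○ ◂ ⊎-∅ʳ))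
                            (⊢↔ (○ ◂ ○ ○ ○ ○ ⊎-∅ˡ))
                            (◂ ▸ ○ ◂ ○ ◂ ⊎-∅ˡ)))
                    (◂ ▸ ○ ▸ v)))
              (◂ ▸ w))

  -- The branching end `b` is dual to `a`, of type `⊕ ⟦ Ss ⟧ˢˢ`, hence `duals`. The shift `1 ↑`
  -- exposes the name `c` bound by each branch.
  ⊢ᴹˢ : ∀ {k} {Δ : Env L n} {Ns : PMap (Term L n) k} {Ss : PMap (STy L) k} {U}
        {ρ : Naming n m} {z : Fin m} {Δ′ Θ : Ctx L m}
        (ds : Branchwise (λ N S → Δ ⊢ᴹ N ∶ sess S ⊸ U) Ns Ss) →
        ⟦ Δ ⟧⊥ ↪[ ρ ] Δ′ → Δ′ ⊎ [ z ∶ ⟦ U ⟧ᵀ ] ≔ Θ →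
        Branchwise (λ P A → P ⊢* just A ∷ Θ)
          (⟦ ds ⟧ᴹˢ (1 ↑ ρ) (# 0) (1 ↑ʳ z)) (duals ⟦ Ss ⟧ˢˢ)
  ⊢ᴹˢ []                    e s = []
  ⊢ᴹˢ (MaybeP.nothing ∷ ds) e s = MaybeP.nothing ∷ ⊢ᴹˢ ds e s
  ⊢ᴹˢ (MaybeP.just d ∷ ds)  e s =
    -- Three shifts: `c`, then the two ends `a`, `b` of the application.
    MaybeP.just (⊢app (⊢ᴹ d (↪-↑ 3 e) ⊎-new)
                      (⊢↔ (▸ ○ ○ ○ ○ ○ ◂ ⊎-∅ʳ))
                      (▸ ⊎-∅ʳ) (◂ s))
    ∷ ⊢ᴹˢ ds e s

-- Name substitution and translated buffers.

-- On `Λ` the substitution is weakening by `k`, and on `x` it is constantly `d`; `↪-join` glues the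
-- two.
⊢-under : ∀ {k} {P : Proc L n} {d : Fin (k + n)} {x : Fin n} {A}
          {Λ Λ′ : Ctx L n} {Λ″ : Ctx L (k + n)} →
          P ⊢* Λ′ → Λ ⊎ [ x ∶ A ] ≔ Λ′ → ∅ {n = k} ++ Λ ⊎ [ d ∶ A ] ≔ Λ″ →
          P under k ⟨ d / x ⟩ ⊢* Λ″
⊢-under {k = k} {d = d} {x} {A} {Λ} p s t = ⊢-rename p (↪-join off-x at-x s t)
  where
  σ = Fun.updateAt (k ↑ʳ_) x (const d)

  agree : ∀ y → lookup Λ y ≡ nothing ⊎ k ↑ʳ y ≡ σ y
  agree y with y ≟ x
  ... | yes refl = inj₁ (⊎-single-fresh x s)
  ... | no y≢x   = inj₂ (sym (updateAt-minimal y x (k ↑ʳ_) y≢x))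

  off-x : Λ ↪[ σ ] ∅ {n = k} ++ Λ
  off-x = ↪-cong agree (↪-↑ k (↪-id Λ))

  at-x : [ x ∶ A ] ↪[ σ ] [ d ∶ A ]
  at-x = subst (λ y → [ x ∶ A ] ↪[ σ ] [ y ∶ A ]) (updateAt-updates x (k ↑ʳ_)) (↪-single x)

-- Each message moves `P` under new binders with `x` replaced by a fresh name, so `P`, `x` and `Λ`
-- vary in the induction. Disjointness of `x` is asked of `Θ` and not of the range of `ρ`, since in
-- a restriction `x` lies in that range.
⊢ᴮ : {Γ : Env L n} {ms : List (Msg L n)} {S′ S : STy L} {ρ : Naming n m} {x : Fin m}
     {P : Proc L m} {Γ′ Λ Λ′ Θ Θ′ : Ctx L m} (b : Γ ⊢ᴮ[ ms ⟩∶ S′ > S) →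
     ⟦ Γ ⟧⊥ ↪[ ρ ] Γ′ →
     P ⊢* Λ′ → Λ ⊎ [ x ∶ dual ⟦ S′ ⟧ˢ ] ≔ Λ′ →
     Γ′ ⊎ Λ ≔ Θ → Θ ⊎ [ x ∶ dual ⟦ S ⟧ˢ ] ≔ Θ′ →
     ⟦ b ⟧ᴮ ρ x P ⊢* Θ′
-- Without messages `Γ′` is empty, so `Θ` is `Λ` and `Θ′` is `Λ′`.
⊢ᴮ T-Buf e p s t u
  with refl ← ↪-⟦∅⟧⊥ e
  with refl ← ⊎-functional t ⊎-∅ˡ
  with refl ← ⊎-functional s u = p
⊢ᴮ (T-BufSend {T = T} {S = S} d b r) e p s t u =
  let _ , _ , e₁ , e₂ , v = ↪-split (⟦⟧⊥-⊎ r) e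
      _ , w , w′          = ⊎-assoc v t
      T≡                  = sym (dual-involutive ⟦ T ⟧ᵀ)
      S≡                  = sym (dual-involutive ⟦ S ⟧ˢ)
  in ⊢ν′ (cong (_⅋ ●) T≡)
       (⊢ν (⊢∣ (⊢ν (⊢∣ (⊢↔ (▸ ○ ○ ○ ○ ○ ⊎-∅ʳ))
                       (⊢⊗′ (cong (λ A → dual A ⊗ ●) T≡) S≡
                         (○ ◂ ○ ○ ▸ ○ ⊎-∅ʳ) (○ ◂ ▸ ○ ◂ ○ ⊎-∅ʳ))
                       (◂ ▸ ▸ ○ ▸ ○ ⊎-∅ʳ)))
               (⊢∣ (⊢⅋● (⊢ᴹ d (↪-↑ 6 e₁) ⊎-new) (○ ○ ○ ▸ ⊎-∅ʳ))
                   -- The remaining messages continue on `d`, which is `# 1`; this frees `x` for the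
                   -- forwarder.
                   (⊢ᴮ b (↪-↑ 4 e₂) (⊢-under p s (○ ▸ ○ ○ ⊎-∅ʳ)) (○ ▸ ○ ○ ⊎-∅ʳ)
                     (○ ○ ○ ○ w) (○ ▸ ○ ○ ⊎-∅ʳ))
                   (○ ▸ ○ ◂ w′))
               (◂ ▸ ◂ ▸ ⊎-comm u)))
⊢ᴮ (T-BufSelect {S = S} b j) e p s t u =
  ⊢ν′ (sym (dual-involutive (dual ⟦ S ⟧ˢ)))
    (⊢∣ (⊢ν (⊢∣ (⊢↔ (▸ ○ ○ ○ ⊎-∅ʳ))
                (⊢⊕ (duals-lookup (⟦⟧-lookup j)) (○ ◂ ▸ ○ ⊎-∅ʳ))
                (◂ ▸ ▸ ○ ⊎-∅ʳ)))
        (⊢ᴮ b (↪-↑ 2 e) (⊢-under p s (○ ▸ ⊎-∅ʳ)) (○ ▸ ⊎-∅ʳ) (○ ○ t) (○ ▸ ⊎-∅ʳ))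
        (◂ ▸ ⊎-comm u))

-- Typing of translated configurations.

⊢ᶜ : {Γ : Env L n} {φ : Marker} {C : Conf L n} {T : Ty L} {ρ : Naming n m} {z : Fin m}
     {Γ′ Θ : Ctx L m} (c : Γ ⊢ᶜ⟨ φ ⟩ C ∶ T) →
     ⟦ Γ ⟧⊥ ↪[ ρ ] Γ′ → Γ′ ⊎ [ z ∶ ⟦ T ⟧ᵀ ] ≔ Θ →
     ⟦ c ⟧ᶜ ρ z ⊢* Θ
⊢ᶜ (T-Main d) e s = ⊢ᴹ d e s
⊢ᶜ (T-Child d) e s = ⊢ᴹ d e s
⊢ᶜ (T-ParL c d u _) e s =
  let _ , _ , e₁ , e₂ , t = ↪-split (⟦⟧⊥-⊎ u) e
      _ , v , w           = ⊎-assoc t s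
  -- The child's result type `𝟏` becomes `●`, so the far end of its result name is supplied by
  -- weakening.
  in ⊢∣ (⊢ν (⊢● {x = # 1} (⊢ᶜ c (↪-↑ 2 e₁) ⊎-new) (◂ ▸ ⊎-∅ʳ))) (⊢ᶜ d e₂ v) w
⊢ᶜ (T-ParR c d u _) e s =
  let _ , _ , e₁ , e₂ , t = ↪-split (⟦⟧⊥-⊎ u) e
      _ , v , w           = ⊎-swapʳ t s
  in ⊢∣ (⊢ᶜ c e₁ v) (⊢ν (⊢● {x = # 1} (⊢ᶜ d (↪-↑ 2 e₂) ⊎-new) (◂ ▸ ⊎-∅ʳ))) w
⊢ᶜ (T-Res {S = S} b c u) e s =
  let _ , _ , e₁ , e₂ , t = ↪-split (⟦⟧⊥-⊎ u) e
      _ , v , w           = ⊎-assoc t s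
  -- `y` has type `dual ⟦ dualˢ S ⟧ˢ`, which `⟦dual⟧` matches with the dual of the type of `x`.
  in ⊢ν′ (cong dual (⟦dual⟧ S))
       (⊢ᴮ b (↪-lift₂ _ _ e₁)
         (⊢ᶜ c (↪-lift₂ _ _ e₂) (◂ ◂ v)) (▸ ◂ ⊎-∅ʳ) (○ ▸ w) (▸ ◂ ⊎-∅ʳ))
⊢ᶜ (T-ResBuf {S = S} b c u) e s =
  let _ , _ , e₁ , e₂ , t = ↪-split (⟦⟧⊥-⊎ u) e
      _ , v , w           = ⊎-assoc t s
  in ⊢ν′ (cong dual (⟦dual⟧ S))
       (⊢ᴮ b (↪-lift₂ _ _ e₁)
         -- Here `y` belongs to the buffer, so its cell is `◂` where `T-Res` has `▸`.
         (⊢ᶜ c (↪-lift₂ _ _ e₂) (◂ ○ v)) (▸ ○ ⊎-∅ʳ) (○ ◂ w) (▸ ◂ ⊎-∅ʳ))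
⊢ᶜ (T-ConfSub {T = T} c d u) e s =
  let _ , _ , e₁ , e₂ , t = ↪-split (⟦⟧⊥-⊎ u) e
      _ , v , w           = ⊎-swapʳ t s
  in ⊢ν′ (sym (dual-involutive ⟦ T ⟧ᵀ))
       (⊢∣ (⊢ᶜ c (keep (↪-↑ 2 e₁) (▸ ○ ⊎-∅ʳ)) (◂ ○ v))
           (⊢ᴹ d (↪-↑ 2 e₂) (○ ▸ ⊎-∅ʳ))
           (◂ ▸ w))

theorem4p4 : (L : ℕ) →
    (∀ {n} {Γ : Env L n} {M : Term L n} {T : Ty L}
    (d : Γ ⊢ᴹ M ∶ T) (z : Fin (suc n)) →
    ⟦ d ⟧ᴹ (punchIn z) z ⊢* dualᴱ ⟦ Γ ⟧ᴱ ,[ z ∶ ⟦ T ⟧ᵀ ])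
    ×
    (∀ {n} {Γ : Env L n} {φ : Marker} {C : Conf L n} {T : Ty L}
    (d : Γ ⊢ᶜ⟨ φ ⟩ C ∶ T) (z : Fin (suc n)) →
    ⟦ d ⟧ᶜ (punchIn z) z ⊢* dualᴱ ⟦ Γ ⟧ᴱ ,[ z ∶ ⟦ T ⟧ᵀ ])
    ×
    (∀ {n} {Γ : Env L n} {ms : List (Msg L n)} {S′ S : STy L}
    (d : Γ ⊢ᴮ[ ms ⟩∶ S′ > S) (x : Fin (suc n)) (P : Proc L (suc n)) {Λ Θ : Ctx L n} →
    P ⊢* Λ ,[ x ∶ dual ⟦ S′ ⟧ˢ ] →
    dualᴱ ⟦ Γ ⟧ᴱ ⊎ Λ ≔ Θ →
    ⟦ d ⟧ᴮ (punchIn x) x P ⊢* Θ ,[ x ∶ dual ⟦ S ⟧ˢ ])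
theorem4p4 L =
    -- `punchIn z` misses exactly `z`, leaving an empty cell that `⊎-insertAt` fills.
    (λ d z → ⊢ᴹ d (↪-punchIn _ z) (⊎-insertAt _ z))
  , (λ c z → ⊢ᶜ c (↪-punchIn _ z) (⊎-insertAt _ z))
  , (λ b x P p s → ⊢ᴮ b (↪-punchIn _ x) p (⊎-insertAt _ x)
                     (⊎-insertAt-nothing x s) (⊎-insertAt _ x))
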